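{- Let $n\ge 1$, $1\le a\le n$, $b=n-a$. Let $\pi=(\pi(1),\dots,\pi(a))$ be a sequence of distinct elements of $[n]$ and $\theta$ an ordering of $[n]\setminus\{\pi(1),\dots,\pi(a)\}$. Let $\mathcal{S}(\theta,\pi)$ be the set of shuffles of $\theta$ and $\pi$, and let $\mathcal{P}(b,a)$ be the set of partitions with exactly $a$ parts (parts allowed to be $0$) each at most $b$, i.e. weakly increasing sequences $0\le\lambda_1\le\cdots\le\lambda_a\le b$ (equivalently multisets of size $a$ from $\{0,\dots,b\}$). For $\sigma\in\mathcal{S}(\theta,\pi)$ and $i=1,\dots,a$ let $\sigma_i$ be the subword of $\sigma$ consisting of the letters of $\theta$ together with $\pi(i),\dots,\pi(a)$, with $\sigma_{a+1}=\theta$; let $m_i=\mathrm{maj}(\sigma_i)-\mathrm{maj}(\sigma_{i+1})$ and $t_i=m_i-d_i(\pi)$. Define $\Phi(\sigma)$ to be the multiset $\{t_1,\dots,t_a\}$. Then $\Phi$ is a bijection from $\mathcal{S}(\theta,\pi)$ onto $\mathcal{P}(b,a)$.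
   Context: For a word $w=w(1)\cdots w(m)$ of distinct integers, index $i\in\{1,\dots,m-1\}$ is a descent if $w(i)>w(i+1)$; $\mathrm{maj}(w)=\sum_{i=1}^{m-1} i\,\chi(w(i)>w(i+1))$ is the sum of the descents; $d_k(w)$ denotes the number of descents of $w$ that are $\ge k$. A shuffle of $\theta$ and $\pi$ is a word of length $n$ (a permutation of $[n]$) containing both $\theta$ and $\pi$ as subwords. -}

module Defs where

open import Data.Nat using (ℕ; zero; suc; _+_; _∸_; _≤_; _<ᵇ_; _≤?_; _<_)
open import Data.Nat.Properties using (≤-totalOrder)
import Data.Nat.Properties as ℕP
open import Data.Integer as ℤ using (ℤ; +_; _-_)
open import Data.Bool using (if_then_else_)
open import Data.Nat.ListAction using (sum)
open import Data.List using (List; []; _∷_; _++_; length; filter; map; upTo; drop)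
open import Data.List.Membership.DecPropositional ℕP._≟_ using (_∈?_)
open import Data.List.Relation.Binary.Permutation.Propositional using (_↭_)
open import Data.List.Relation.Binary.Sublist.Propositional using (_⊆_)
open import Data.List.Relation.Unary.All using (All)
open import Data.List.Relation.Unary.Linked using (Linked)
open import Data.Product using (_×_)
open import Relation.Binary.PropositionalEquality using (_≡_)
open import Relation.Nullary.Decidable using (_⊎-dec_; ¬?)

Word : Set
Word = List ℕ

range : ℕ → List ℕ
range n = map suc (upTo n)

-- descent positions (1-indexed) of a word; descAux k w lists the descents
-- of w when the first letter of w sits at position k.
descAux : ℕ → Word → List ℕ
descAux k [] = []
descAux k (x ∷ []) = []
descAux k (x ∷ y ∷ rest) =
  (if y <ᵇ x then k ∷ [] else []) ++ descAux (suc k) (y ∷ rest)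

descents : Word → List ℕ
descents w = descAux 1 w

maj : Word → ℕ
maj w = sum (descents w)

d : ℕ → Word → ℕ
d k w = length (filter (k ≤?_) (descents w))

IsShuffle : ℕ → Word → Word → Word → Set
IsShuffle n θ π σ = (σ ↭ range n) × (θ ⊆ σ) × (π ⊆ σ)

subσ : Word → Word → Word → ℕ → Word
subσ θ π σ i =
  if length π <ᵇ i then θ
  else filter (λ x → (x ∈? θ) ⊎-dec (x ∈? drop (i ∸ 1) π)) σ

mᵢ : Word → Word → Word → ℕ → ℤ
mᵢ θ π σ i = + maj (subσ θ π σ i) - + maj (subσ θ π σ (suc i))

tᵢ : Word → Word → Word → ℕ → ℤ
tᵢ θ π σ i = mᵢ θ π σ i - + d i π

-- Φ(σ) = multiset {t_1,...,t_a}, represented by the list [t_1,...,t_a]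
-- (multisets are compared up to permutation _↭_).
Φ : Word → Word → Word → List ℤ
Φ θ π σ = map (tᵢ θ π σ) (range (length π))

IsPartition : ℕ → ℕ → List ℕ → Set
IsPartition b a λ′ = (length λ′ ≡ a) × All (_≤ b) λ′ × Linked _≤_ λ′

{-# OPTIONS --safe #-}

-- Build σ from right to left, each step taking the last unused letter x of θ or the last unused
-- letter r of π.  Let w be the suffix built so far, πs the part of π already used, and j the number of
-- unused letters of θ.  Attach to this state the interval [e , e + j] with e = des (r w) − des (r πs);
-- it is [0 , b] at the start.  Taking x removes one endpoint of the interval, and taking r leaves the
-- interval unchanged but contributes to Φ(σ) exactly the endpoint that taking x would have removed.
-- Hence the multiset of the remaining contributions determines the next step: r must be taken if and
-- only if that endpoint occurs in the multiset.
module Submission where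

open import Defs
open import Data.Nat using (ℕ; suc; _+_; _*_; _≤_; _<_; _∸_; _<ᵇ_; _≤?_; z≤n; s≤s; s≤s⁻¹)
open import Data.Integer as ℤ using (+_; _-_)
import Data.Integer.Properties as ℤP
open import Data.Bool using (Bool; true; false; if_then_else_; _∧_; _∨_; not)
open import Data.Empty using (⊥-elim)
open import Data.Unit using (⊤; tt)
open import Data.Sum using (_⊎_; inj₁; inj₂; [_,_]′)
open import Data.List using (List; []; _∷_; _++_; _ʳ++_; reverse; length; map; filter; drop; upTo; downFrom)
import Data.List.Properties as LP
import Data.Nat.Properties as ℕP
open import Data.Nat.Solver using (module +-*-Solver)
open import Data.Nat.ListAction using (sum)
open import Data.List.Membership.DecPropositional ℕP._≟_ using (_∈_; _∉_; _∈?_)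
open import Data.List.Membership.Propositional.Properties using (∈-∃++; ∈-filter⁺; ∈-filter⁻; ∈-map⁺; ∈-upTo⁺; ∈-++⁻; ∈-++⁺ˡ; ∈-++⁺ʳ)
open import Data.List.Membership.Propositional.Properties.WithK using (unique∧set⇒bag)
open import Data.List.Relation.Binary.BagAndSetEquality using (∼bag⇒↭)
open import Data.List.Relation.Binary.Disjoint.Propositional using (Disjoint)
open import Data.List.Relation.Binary.Permutation.Propositional using (_↭_; ↭-refl; ↭-reflexive; ↭-sym; ↭-trans; prep; module PermutationReasoning)
open import Data.List.Relation.Binary.Permutation.Propositional.Properties using (All-resp-↭; ∈-resp-↭; drop-∷; shift; ↭-length; ↭-reverse; ↭-map-inv; ++⁺ʳ) renaming (map⁺ to ↭-map⁺)
open import Data.List.Relation.Binary.Sublist.Propositional using (_⊆_; []; _∷_; _∷ʳ_)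
open import Data.List.Relation.Ternary.Interleaving.Propositional using (Interleaving; []; consˡ; consʳ; toPermutation)
open import Data.List.Relation.Ternary.Interleaving.Properties using (reverse⁺; reverse⁻)
open import Data.List.Relation.Unary.All as All using (All; []; _∷_)
open import Data.List.Relation.Unary.Any using (here; there)
open import Data.List.Relation.Unary.Any.Properties using (reverseAcc⁺) renaming (reverse⁻ to ∈-reverse⁻)
open import Data.List.Relation.Unary.Unique.Propositional using (Unique)
open import Data.List.Relation.Unary.Unique.Propositional.Properties using (Unique[x∷xs]⇒x∉xs; upTo⁺; drop⁺) renaming (map⁺ to Unique-map⁺; ++⁺ to Unique-++⁺; filter⁺ to Unique-filter⁺)
open import Data.List.Sort ℕP.≤-decTotalOrder using (sort; sort-↭; sort-↗)
open import Data.Product using (_×_; ∃; _,_; proj₁; proj₂)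
open import Function using (_∘_; _$_)
open import Function.Bundles using (mk⇔)
open import Relation.Binary.PropositionalEquality using (_≡_; _≢_; refl; sym; trans; cong; cong₂; subst; module ≡-Reasoning)
open import Relation.Nullary using (¬_; yes; no; contradiction)
open import Relation.Nullary.Decidable using (¬?; _⊎-dec_)
open import Relation.Nullary.Reflects using (ofʸ; ofⁿ)
open import Relation.Unary using (Decidable)

-- Labels of an interleaving and the shrinking interval

𝟙 : Bool → ℕ
𝟙 b = if b then 1 else 0

des : Word → ℕ
des (x ∷ y ∷ w) = 𝟙 (y <ᵇ x) + des (y ∷ w)
des _           = 0

-- Inserting r right after x and before w increases the number of descents.
raises : ℕ → ℕ → Word → Bool
raises r x []      = r <ᵇ x
raises r x (y ∷ _) = if y <ᵇ x then (r <ᵇ x) ∧ (y <ᵇ r) else (r <ᵇ x) ∨ (y <ᵇ r)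

-- U and P are the unused parts of θ and π read backwards, so their heads are the letters x and r.
endpoint : ℕ → List ℕ → Word → ℕ → ℕ
endpoint r []      w e = e
endpoint r (x ∷ U) w e = e + 𝟙 (raises r x w) * suc (length U)

-- If `r` raises, the top endpoint goes and the lower one stays; otherwise the lower endpoint goes.
-- With no letter of π left there is no `r` to compare with, and `e` is a default that keeps the new
-- interval inside the old one.
lower : List ℕ → ℕ → Word → ℕ → ℕ
lower []      x w e = e
lower (r ∷ _) x w e = e + 𝟙 (not (raises r x w))

-- `s` lists the letters still to be put in front of `w`, nearest first, so the complete word is
-- `s ʳ++ w`. The label of the last letter of π comes first.
labels : ∀ {U P s} → Interleaving U P s → ℕ → Word → List ℕ
labels []                        e w = []
labels {x ∷ U} {P}     (consˡ p) e w = labels p (lower P x w e) (x ∷ w)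
labels {U}     {r ∷ P} (consʳ p) e w = endpoint r U w e ∷ labels p e (r ∷ w)

Within : ℕ → ℕ → ℕ → Set
Within e j t = e ≤ t × t ≤ e + j

endpoint-within : ∀ r U w e → Within e (length U) (endpoint r U w e)
endpoint-within r []      w e = ℕP.≤-refl , ℕP.m≤m+n e 0
endpoint-within r (x ∷ U) w e with raises r x w
... | true  = ℕP.m≤m+n e _ , ℕP.≤-reflexive (cong (λ z → e + z) (ℕP.+-identityʳ _))
... | false = ℕP.m≤m+n e 0 , ℕP.+-monoʳ-≤ e z≤n

lower-shrinks : ∀ P x w e {j t} → Within (lower P x w e) j t → Within e (suc j) t
lower-shrinks []      x w e {j} (l , u) = l , ℕP.≤-trans u (ℕP.+-monoʳ-≤ e (ℕP.n≤1+n j))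
lower-shrinks (r ∷ _) x w e {j} {t} (l , u) with raises r x w
... | true  = ℕP.≤-trans (ℕP.m≤m+n e 0) l ,
              ℕP.≤-trans u (ℕP.+-mono-≤ (ℕP.≤-reflexive (ℕP.+-identityʳ e)) (ℕP.n≤1+n j))
... | false = ℕP.≤-trans (ℕP.m≤m+n e 1) l , subst (t ≤_) (ℕP.+-assoc e 1 j) u

endpoint-removed : ∀ r P x U w e →
  ¬ Within (lower (r ∷ P) x w e) (length U) (endpoint r (x ∷ U) w e)
endpoint-removed r P x U w e (l , u) with raises r x w
... | true  rewrite ℕP.+-identityʳ e | ℕP.+-identityʳ (length U) =
  ℕP.1+n≰n (ℕP.+-cancelˡ-≤ e _ _ u)
... | false with () ← ℕP.+-cancelˡ-≤ e _ _ l

only-endpoint-removed : ∀ r P x U w e {t} → Within e (suc (length U)) t → endpoint r (x ∷ U) w e ≢ t →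
  Within (lower (r ∷ P) x w e) (length U) t
only-endpoint-removed r P x U w e {t} (l , u) t≢ with raises r x w
... | true  rewrite ℕP.+-identityʳ e | ℕP.+-identityʳ (length U) =
  l , s≤s⁻¹ (subst (t <_) (ℕP.+-suc e _) (ℕP.≤∧≢⇒< u (t≢ ∘ sym)))
... | false rewrite ℕP.+-identityʳ e =
  subst (_≤ t) (ℕP.+-comm 1 e) (ℕP.≤∧≢⇒< l t≢) , subst (t ≤_) (sym (ℕP.+-assoc e 1 _)) u

labels-within : ∀ {U P s} (p : Interleaving U P s) e w → All (Within e (length U)) (labels p e w)
labels-within []                        e w = []
labels-within {x ∷ U} {P}     (consˡ p) e w = All.map (lower-shrinks P x w e) (labels-within p _ _)
labels-within {U}     {r ∷ P} (consʳ p) e w = endpoint-within r U w e ∷ labels-within p e (r ∷ w)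

length-labels : ∀ {U P s} (p : Interleaving U P s) e w → length (labels p e w) ≡ length P
length-labels []        e w = refl
length-labels (consˡ p) e w = length-labels p _ _
length-labels (consʳ p) e w = cong suc (length-labels p _ _)

-- Taking `r` makes the endpoint a label, while taking `x` confines all later labels to an interval
-- that has lost it.
labels-consˡ≁consʳ : ∀ {x r U P s s′} (p : Interleaving U (r ∷ P) s) (q : Interleaving (x ∷ U) P s′) e w →
  ¬ (labels (consˡ p) e w ↭ labels (consʳ q) e w)
labels-consˡ≁consʳ {x} {r} {U} {P} p q e w eq = endpoint-removed r P x U w e
  (All.lookup (labels-within p _ _) (∈-resp-↭ (↭-sym eq) (here refl)))

labels-injective : ∀ {U P s s′} (p : Interleaving U P s) (q : Interleaving U P s′) e w →
  labels p e w ↭ labels q e w → s ≡ s′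
labels-injective []        []        e w eq = refl
labels-injective (consˡ p) (consˡ q) e w eq = cong (_ ∷_) (labels-injective p q _ _ eq)
labels-injective (consˡ p) (consʳ q) e w eq = contradiction eq (labels-consˡ≁consʳ p q e w)
labels-injective (consʳ p) (consˡ q) e w eq = contradiction (↭-sym eq) (labels-consˡ≁consʳ q p e w)
labels-injective (consʳ p) (consʳ q) e w eq = cong (_ ∷_) (labels-injective p q _ _ (drop-∷ eq))

LabelsSurjective : List ℕ → List ℕ → Set
LabelsSurjective U P = ∀ e w ts → length ts ≡ length P → All (Within e (length U)) ts →
  ∃ λ s → ∃ λ (p : Interleaving U P s) → labels p e w ↭ ts

-- If the endpoint is missing from `ts`, all targets survive its removal and `x` can be taken.
-- Otherwise one copy is split off as the label of `r`, and the other targets keep their bounds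
-- because the interval is unchanged.
labels-surjective-step : ∀ {x r U P} → LabelsSurjective U (r ∷ P) → LabelsSurjective (x ∷ U) P →
  LabelsSurjective (x ∷ U) (r ∷ P)
labels-surjective-step {x} {r} {U} {P} surjˡ surjʳ e w ts len wi with endpoint r (x ∷ U) w e ∈? ts
... | no t∉ts =
  let wi′        = All.tabulate λ t∈ts → only-endpoint-removed r P x U w e (All.lookup wi t∈ts)
                                           (λ eq → t∉ts (subst (_∈ ts) (sym eq) t∈ts))
      s , p , eq = surjˡ (lower (r ∷ P) x w e) (x ∷ w) ts len wi′
  in x ∷ s , consˡ p , eq
... | yes t∈ts with xs , ys , refl ← ∈-∃++ t∈ts =
  let moved      = shift (endpoint r (x ∷ U) w e) xs ys
      s , p , eq = surjʳ e (r ∷ w) (xs ++ ys)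
                     (ℕP.suc-injective (trans (sym (↭-length moved)) len)) (All.tail (All-resp-↭ moved wi))
  in r ∷ s , consʳ p , ↭-trans (prep _ eq) (↭-sym moved)

labels-surjective : ∀ U P → LabelsSurjective U P
labels-surjective []      []      e w []       len wi = [] , [] , ↭-refl
labels-surjective (x ∷ U) []      e w []       len wi =
  let s , p , eq = labels-surjective U [] e (x ∷ w) [] refl [] in x ∷ s , consˡ p , eq
labels-surjective []      (r ∷ P) e w (t ∷ ts) len ((l , u) ∷ wi) =
  let s , p , eq = labels-surjective [] P e (r ∷ w) ts (ℕP.suc-injective len) wi
      -- With θ exhausted the interval is the single point `e`, so every target equals it.
      e≡t        = ℕP.≤-antisym l (subst (t ≤_) (ℕP.+-identityʳ e) u)
  in r ∷ s , consʳ p , subst (λ z → z ∷ labels p e (r ∷ w) ↭ t ∷ ts) (sym e≡t) (prep t eq)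
labels-surjective (x ∷ U) (r ∷ P) = labels-surjective-step (labels-surjective U (r ∷ P)) (labels-surjective (x ∷ U) P)

-- Descents and the major index under insertion of a letter

-- Putting `r` between `x` and `y` changes the number of descents by 0 or 1: transitivity of the
-- order rules out the two patterns that would give 2 or -1.
exchange : ∀ r x y w → 𝟙 (r <ᵇ x) + 𝟙 (y <ᵇ r) ≡ 𝟙 (y <ᵇ x) + 𝟙 (raises r x (y ∷ w))
exchange r x y w with r <ᵇ x | ℕP.<ᵇ-reflects-< r x | y <ᵇ r | ℕP.<ᵇ-reflects-< y r | y <ᵇ x | ℕP.<ᵇ-reflects-< y x
... | true  | _         | true  | _         | true  | _         = refl
... | true  | ofʸ r<x   | true  | ofʸ y<r   | false | ofⁿ y≮x   = contradiction (ℕP.<-trans y<r r<x) y≮x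
... | true  | _         | false | _         | true  | _         = refl
... | true  | _         | false | _         | false | _         = refl
... | false | _         | true  | _         | true  | _         = refl
... | false | _         | true  | _         | false | _         = refl
... | false | ofⁿ r≮x   | false | ofⁿ y≮r   | true  | ofʸ y<x   =
  contradiction (ℕP.<-≤-trans y<x (ℕP.≤-trans (ℕP.≮⇒≥ r≮x) (ℕP.≮⇒≥ y≮r))) (ℕP.<-irrefl refl)
... | false | _         | false | _         | false | _         = refl

<ᵇ-flip : ∀ {r x} → r ≢ x → (x <ᵇ r) ≡ not (r <ᵇ x)
<ᵇ-flip {r} {x} r≢x with r <ᵇ x | ℕP.<ᵇ-reflects-< r x | x <ᵇ r | ℕP.<ᵇ-reflects-< x r
... | true  | ofʸ r<x | true  | ofʸ x<r = contradiction x<r (ℕP.<-asym r<x)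
... | true  | _       | false | _       = refl
... | false | _       | true  | _       = refl
... | false | ofⁿ r≮x | false | ofⁿ x≮r = contradiction (ℕP.≤-antisym (ℕP.≮⇒≥ x≮r) (ℕP.≮⇒≥ r≮x)) r≢x

𝟙-not : ∀ b → 𝟙 b + 𝟙 (not b) ≡ 1
𝟙-not true  = refl
𝟙-not false = refl

-- This is how the lower end changes when `x` is taken: of the two descents at `x`, the one from `r`
-- is the complement of `r <ᵇ x`, and `exchange` evaluates the other.
des-move : ∀ {r x} w → r ≢ x → des (r ∷ x ∷ w) ≡ des (r ∷ w) + 𝟙 (not (raises r x w))
des-move {r} {x} []      r≢x = trans (ℕP.+-identityʳ _) (cong 𝟙 (<ᵇ-flip r≢x))
-- Adding `𝟙 (r <ᵇ x) + 𝟙 up` to both sides turns complements into sums equal to 1 and avoids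
-- subtraction.
des-move {r} {x} (y ∷ w) r≢x = ℕP.+-cancelˡ-≡ (𝟙 (r <ᵇ x) + 𝟙 up) _ _ $ begin
  (a + 𝟙 up) + (𝟙 (x <ᵇ r) + (c + D))            ≡⟨ cong (λ z → (a + 𝟙 up) + (𝟙 z + (c + D))) (<ᵇ-flip r≢x) ⟩
  (a + 𝟙 up) + (𝟙 (not (r <ᵇ x)) + (c + D))      ≡⟨ solve 5 (λ a u n c D → (a :+ u) :+ (n :+ (c :+ D)) := (a :+ n) :+ ((c :+ u) :+ D)) refl a (𝟙 up) (𝟙 (not (r <ᵇ x))) c D ⟩
  (a + 𝟙 (not (r <ᵇ x))) + ((c + 𝟙 up) + D)      ≡⟨ cong₂ (λ y z → y + (z + D)) (trans (𝟙-not (r <ᵇ x)) (sym (𝟙-not up))) (sym (exchange r x y w)) ⟩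
  (𝟙 up + 𝟙 (not up)) + ((a + b) + D)            ≡⟨ solve 5 (λ u n a b D → (u :+ n) :+ ((a :+ b) :+ D) := (a :+ u) :+ ((b :+ D) :+ n)) refl (𝟙 up) (𝟙 (not up)) a b D ⟩
  (a + 𝟙 up) + ((b + D) + 𝟙 (not up))            ∎
  where
  open ≡-Reasoning
  open +-*-Solver
  up = raises r x (y ∷ w)
  a  = 𝟙 (r <ᵇ x)
  b  = 𝟙 (y <ᵇ r)
  c  = 𝟙 (y <ᵇ x)
  D  = des (y ∷ w)

majFrom : ℕ → Word → ℕ
majFrom k w = sum (descAux k w)

majFrom-∷∷ : ∀ k x y w → majFrom k (x ∷ y ∷ w) ≡ 𝟙 (y <ᵇ x) * k + majFrom (suc k) (y ∷ w)
majFrom-∷∷ k x y w with y <ᵇ x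
... | true  = cong (λ z → z + majFrom (suc k) (y ∷ w)) (sym (ℕP.+-identityʳ k))
... | false = refl

majFrom-suc : ∀ k w → majFrom (suc k) w ≡ majFrom k w + des w
majFrom-suc k []          = refl
majFrom-suc k (x ∷ [])    = refl
majFrom-suc k (x ∷ y ∷ w) = begin
  majFrom (suc k) (x ∷ y ∷ w)        ≡⟨ majFrom-∷∷ (suc k) x y w ⟩
  c * suc k + majFrom (2 + k) (y ∷ w)  ≡⟨ cong (λ z → c * suc k + z) (majFrom-suc (suc k) (y ∷ w)) ⟩
  c * suc k + (M + D)                ≡⟨ solve 4 (λ c k M D → c :* (con 1 :+ k) :+ (M :+ D) := (c :* k :+ M) :+ (c :+ D)) refl c k M D ⟩
  (c * k + M) + (c + D)              ≡⟨ cong (λ z → z + (c + D)) (majFrom-∷∷ k x y w) ⟨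
  majFrom k (x ∷ y ∷ w) + (c + D)    ∎
  where
  open ≡-Reasoning
  open +-*-Solver
  c = 𝟙 (y <ᵇ x)
  M = majFrom (suc k) (y ∷ w)
  D = des (y ∷ w)

-- The descents of `w` move one place to the right and add `des w`. A descent at `r` has weight
-- `k + 1`: its extra 1 completes `des (r ∷ w)`, and by `exchange` what remains at weight `k` is the
-- old descent at `x` plus `raises`.
majFrom-insert : ∀ k x r w →
  majFrom k (x ∷ r ∷ w) ≡ majFrom k (x ∷ w) + (des (r ∷ w) + 𝟙 (raises r x w) * k)
majFrom-insert k x r []      rewrite majFrom-∷∷ k x r [] = ℕP.+-identityʳ _
majFrom-insert k x r (y ∷ w) = begin
  majFrom k (x ∷ r ∷ y ∷ w)
    ≡⟨ trans (majFrom-∷∷ k x r (y ∷ w)) (cong (λ z → a * k + z) (majFrom-∷∷ (suc k) r y w)) ⟩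
  a * k + (b * suc k + majFrom (suc (suc k)) (y ∷ w))
    ≡⟨ cong (λ z → a * k + (b * suc k + z)) (majFrom-suc (suc k) (y ∷ w)) ⟩
  a * k + (b * suc k + (M + D))
    ≡⟨ solve 5 (λ a b k M D → a :* k :+ (b :* (con 1 :+ k) :+ (M :+ D)) := (a :+ b) :* k :+ (M :+ (b :+ D))) refl a b k M D ⟩
  (a + b) * k + (M + (b + D))
    ≡⟨ cong (λ z → z * k + (M + (b + D))) (exchange r x y w) ⟩
  (c + u) * k + (M + (b + D))
    ≡⟨ solve 6 (λ c u k M b D → (c :+ u) :* k :+ (M :+ (b :+ D)) := (c :* k :+ M) :+ ((b :+ D) :+ u :* k)) refl c u k M b D ⟩
  (c * k + M) + ((b + D) + u * k)
    ≡⟨ cong (λ z → z + ((b + D) + u * k)) (majFrom-∷∷ k x y w) ⟨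
  majFrom k (x ∷ y ∷ w) + ((b + D) + u * k) ∎
  where
  open ≡-Reasoning
  open +-*-Solver
  a = 𝟙 (r <ᵇ x)
  b = 𝟙 (y <ᵇ r)
  c = 𝟙 (y <ᵇ x)
  u = 𝟙 (raises r x (y ∷ w))
  M = majFrom (suc k) (y ∷ w)
  D = des (y ∷ w)

-- Both tails begin with the same `x`, so the descents inside `v` and at its junction with the tail
-- agree.
majFrom-prefix : ∀ v k {x z z′ c} → majFrom (length v + k) (x ∷ z′) ≡ majFrom (length v + k) (x ∷ z) + c →
  majFrom k (v ++ x ∷ z′) ≡ majFrom k (v ++ x ∷ z) + c
majFrom-prefix []      k eq = eq
majFrom-prefix (y ∷ v) k {x} {z} {z′} {c} eq = first v (majFrom-prefix v (suc k)
  (subst (λ j → majFrom j (x ∷ z′) ≡ majFrom j (x ∷ z) + c) (sym (ℕP.+-suc (length v) k)) eq))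
  where
  -- The letter after `y` is the head of `v` or `x`; the case split exposes it so that the first
  -- descent can be separated.
  first : ∀ v → majFrom (suc k) (v ++ x ∷ z′) ≡ majFrom (suc k) (v ++ x ∷ z) + c →
    majFrom k (y ∷ v ++ x ∷ z′) ≡ majFrom k (y ∷ v ++ x ∷ z) + c
  first []      eq rewrite majFrom-∷∷ k y x z′ | majFrom-∷∷ k y x z | eq = sym (ℕP.+-assoc (𝟙 (x <ᵇ y) * k) _ _)
  first (h ∷ v) eq rewrite majFrom-∷∷ k y h (v ++ x ∷ z′) | majFrom-∷∷ k y h (v ++ x ∷ z) | eq =
    sym (ℕP.+-assoc (𝟙 (h <ᵇ y) * k) _ _)

-- For `D = d_i(π)` this says that `t_i` is the endpoint: the hypothesis splits the `des (r ∷ w)` of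
-- `majFrom-insert` into `e` and `D`.
maj-insert : ∀ U r w e {D} → e + D ≡ des (r ∷ w) →
  maj (U ʳ++ r ∷ w) ≡ maj (U ʳ++ w) + (endpoint r U w e + D)
maj-insert []      r []      e eq = sym eq
maj-insert []      r (y ∷ w) e {D} eq = begin
  -- Counting positions from 0, a descent at `r` weighs nothing and `y ∷ w` starts at 1, as it does
  -- without `r`; shifting back costs the number of descents.
  majFrom 1 (r ∷ y ∷ w)                           ≡⟨ majFrom-suc 0 (r ∷ y ∷ w) ⟩
  majFrom 0 (r ∷ y ∷ w) + des (r ∷ y ∷ w)         ≡⟨ cong₂ _+_ (majFrom-∷∷ 0 r y w) (sym eq) ⟩
  (𝟙 (y <ᵇ r) * 0 + majFrom 1 (y ∷ w)) + (e + D)  ≡⟨ cong (λ z → (z + majFrom 1 (y ∷ w)) + (e + D)) (ℕP.*-zeroʳ (𝟙 (y <ᵇ r))) ⟩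
  majFrom 1 (y ∷ w) + (e + D)                     ∎
  where open ≡-Reasoning
maj-insert (x ∷ U) r w e {D} eq
  rewrite LP.ʳ++-defn U {x ∷ r ∷ w} | LP.ʳ++-defn U {x ∷ w} =
  majFrom-prefix (reverse U) 1 $ begin
    majFrom j (x ∷ r ∷ w)                      ≡⟨ majFrom-insert j x r w ⟩
    majFrom j (x ∷ w) + (des (r ∷ w) + u * j)  ≡⟨ cong₂ (λ d i → majFrom j (x ∷ w) + (d + u * i)) (sym eq) j≡ ⟩
    majFrom j (x ∷ w) + (e + D + u * suc (length U))
      ≡⟨ cong (λ z → majFrom j (x ∷ w) + z) (solve 3 (λ e D v → e :+ D :+ v := e :+ v :+ D) refl e D (u * suc (length U))) ⟩
    majFrom j (x ∷ w) + (e + u * suc (length U) + D) ∎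
  where
  open ≡-Reasoning
  open +-*-Solver
  -- The position of `x`, which follows the letters of `reverse U`; it equals the width
  -- `length (x ∷ U)` of the interval.
  j = length (reverse U) + 1
  u = 𝟙 (raises r x w)
  j≡ : j ≡ suc (length U)
  j≡ = trans (ℕP.+-comm _ 1) (cong suc (LP.length-reverse U))

descAux-≥ : ∀ {m} k w → m ≤ k → All (m ≤_) (descAux k w)
descAux-≥ k []          m≤k = []
descAux-≥ k (x ∷ [])    m≤k = []
descAux-≥ k (x ∷ y ∷ w) m≤k with y <ᵇ x | descAux-≥ (suc k) (y ∷ w) (ℕP.m≤n⇒m≤1+n m≤k)
... | true  | ih = m≤k ∷ ih
... | false | ih = ih

length-descAux : ∀ k w → length (descAux k w) ≡ des w
length-descAux k []          = refl
length-descAux k (x ∷ [])    = refl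
length-descAux k (x ∷ y ∷ w) with y <ᵇ x | length-descAux (suc k) (y ∷ w)
... | true  | ih = cong suc ih
... | false | ih = ih

filter-descAux-∷ : ∀ {m} k x w → k < m →
  filter (m ≤?_) (descAux k (x ∷ w)) ≡ filter (m ≤?_) (descAux (suc k) w)
filter-descAux-∷     k x []      k<m = refl
filter-descAux-∷ {m} k x (y ∷ w) k<m with y <ᵇ x
... | true  = LP.filter-reject (m ≤?_) (ℕP.<⇒≱ k<m)
... | false = refl

filter-descAux-++ : ∀ v k z {m} → m ≡ length v + k → filter (m ≤?_) (descAux k (v ++ z)) ≡ descAux m z
filter-descAux-++ []      k z refl = LP.filter-all (k ≤?_) (descAux-≥ k z ℕP.≤-refl)
filter-descAux-++ (x ∷ v) k z refl = trans
  (filter-descAux-∷ k x (v ++ z) (s≤s (ℕP.m≤n+m k (length v))))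
  (filter-descAux-++ v (suc k) z (sym (ℕP.+-suc (length v) k)))

-- A descent at the junction has position `length P`, one below the threshold, so exactly the
-- descents inside `z` are counted.
d-suffix : ∀ P z → d (suc (length P)) (P ʳ++ z) ≡ des z
d-suffix P z = begin
  d (suc (length P)) (P ʳ++ z)          ≡⟨ cong (d (suc (length P))) (LP.ʳ++-defn P) ⟩
  d (suc (length P)) (reverse P ++ z)   ≡⟨ cong length (filter-descAux-++ (reverse P) 1 z
                                             (trans (cong suc (sym (LP.length-reverse P))) (ℕP.+-comm 1 _))) ⟩
  length (descAux (suc (length P)) z)   ≡⟨ length-descAux _ z ⟩
  des z                                 ∎
  where open ≡-Reasoning

-- The words σ_i

filter-interleaving : ∀ {Q : ℕ → Set} (Q? : Decidable Q) {U P s} → Interleaving U P s →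
  All Q U → All (¬_ ∘ Q) P → ∀ w → filter Q? (s ʳ++ w) ≡ U ʳ++ filter Q? w
filter-interleaving Q? []        []        []         w = refl
filter-interleaving Q? {U = x ∷ U} (consˡ p) (qx ∷ qU) ¬qP        w =
  trans (filter-interleaving Q? p qU ¬qP (x ∷ w)) (cong (U ʳ++_) (LP.filter-accept Q? qx))
filter-interleaving Q? {U} {r ∷ _} (consʳ p) qU        (¬qr ∷ ¬qP) w =
  trans (filter-interleaving Q? p qU ¬qP (r ∷ w)) (cong (U ʳ++_) (LP.filter-reject Q? ¬qr))

drop-ʳ++ : ∀ (P : List ℕ) {z} → drop (length P) (P ʳ++ z) ≡ z
drop-ʳ++ P {z} = begin
  drop (length P) (P ʳ++ z)                     ≡⟨ cong₂ drop (sym (LP.length-reverse P)) (LP.ʳ++-defn P) ⟩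
  drop (length (reverse P)) (reverse P ++ z)    ≡⟨ drop-++ (reverse P) ⟩
  z                                             ∎
  where
  open ≡-Reasoning
  drop-++ : ∀ v → drop (length v) (v ++ z) ≡ z
  drop-++ []      = refl
  drop-++ (_ ∷ v) = drop-++ v

Unique-ʳ++ : ∀ P {z} → Unique (P ʳ++ z) → All (_∉ z) P
Unique-ʳ++ []      u = []
Unique-ʳ++ (r ∷ P) {z} u =
  Unique[x∷xs]⇒x∉xs (subst Unique (drop-ʳ++ P) (drop⁺ (length P) u))
  ∷ All.map (_∘ there) (Unique-ʳ++ P u)

-- The word `σ_{a+1}` is set to θ by a separate branch. The last hypothesis says that the filter
-- agrees with it at `k = a`, so one formula covers all `k ≤ a`.
subσ-suc : ∀ θ π σ k → k ≤ length π →
  filter (λ x → (x ∈? θ) ⊎-dec (x ∈? drop (length π) π)) σ ≡ θ →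
  subσ θ π σ (suc k) ≡ filter (λ x → (x ∈? θ) ⊎-dec (x ∈? drop k π)) σ
subσ-suc θ π σ k k≤a eq with length π <ᵇ suc k | ℕP.<ᵇ-reflects-< (length π) (suc k)
... | false | _         = refl
... | true  | ofʸ a<1+k rewrite ℕP.≤-antisym k≤a (s≤s⁻¹ a<1+k) = sym eq

difference : ∀ {m m′ t D} → m ≡ m′ + (t + D) → + t ≡ + m - + m′ - + D
difference {m′ = m′} {t} {D} refl = sym $ begin
  + (m′ + (t + D)) - + m′ - + D   ≡⟨ cong (_- + D) (ℤP.m-n≡m⊖n (m′ + (t + D)) m′) ⟩
  (m′ + (t + D)) ℤ.⊖ m′ - + D     ≡⟨ cong (_- + D) (ℤP.⊖-≥ (ℕP.m≤m+n m′ (t + D))) ⟩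
  + (m′ + (t + D) ∸ m′) - + D     ≡⟨ cong (λ z → + z - + D) (ℕP.m+n∸m≡n m′ (t + D)) ⟩
  + (t + D) - + D                 ≡⟨ ℤP.m-n≡m⊖n (t + D) D ⟩
  (t + D) ℤ.⊖ D                   ≡⟨ ℤP.⊖-≥ (ℕP.m≤n+m D t) ⟩
  + (t + D ∸ D)                   ≡⟨ cong +_ (ℕP.m+n∸n≡m t D) ⟩
  + t                             ∎
  where open ≡-Reasoning

-- Identification of the labels with the numbers `t_i`

module _ {θ π : Word} (θ#π : Disjoint θ π) (π! : Unique π) where

  keep? : ∀ k → Decidable (λ x → x ∈ θ ⊎ x ∈ drop k π)
  keep? k x = (x ∈? θ) ⊎-dec (x ∈? drop k π)

  -- The letters of `P` are rejected: they avoid θ by disjointness and `πs` because π has no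
  -- repeated letter. All others are kept.
  filter-state : ∀ {U P s} w πs → Interleaving U P s → π ≡ P ʳ++ πs →
    All (_∈ θ) U → All (λ x → x ∈ θ ⊎ x ∈ πs) w →
    filter (keep? (length P)) (s ʳ++ w) ≡ U ʳ++ w
  filter-state {U} {P} w πs p π≡ U∈ w∈ = trans
    (filter-interleaving (keep? (length P)) p (All.map inj₁ U∈) P∉ w)
    (cong (U ʳ++_) (LP.filter-all (keep? (length P)) (subst (λ z → All (λ x → x ∈ θ ⊎ x ∈ z) w) (sym drop≡) w∈)))
    where
    drop≡ : drop (length P) π ≡ πs
    drop≡ = trans (cong (drop (length P)) π≡) (drop-ʳ++ P)
    P∉ : All (λ r → ¬ (r ∈ θ ⊎ r ∈ drop (length P) π)) P
    P∉ = All.tabulate λ {r} r∈P → λ where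
      (inj₁ r∈θ) → θ#π (r∈θ , subst (r ∈_) (sym π≡) (reverseAcc⁺ πs P (inj₂ r∈P)))
      (inj₂ r∈d) → All.lookup (Unique-ʳ++ P (subst Unique π≡ π!)) r∈P (subst (r ∈_) drop≡ r∈d)

  -- The invariant `e = des (r w) − des (r πs)` in additive form, where `r` is the next letter of π.
  Lower : ℕ → List ℕ → Word → Word → Set
  Lower e []      w πs = ⊤
  Lower e (r ∷ _) w πs = e + des (r ∷ πs) ≡ des (r ∷ w)

  -- The next letter `q` stands before `r` in both words, so both descent numbers gain the same
  -- `𝟙 (r <ᵇ q)`.
  Lower-place : ∀ {e r} P w πs → Lower e (r ∷ P) w πs → Lower e P (r ∷ w) (r ∷ πs)
  Lower-place []               w πs eq = tt
  Lower-place {e} {r} (q ∷ P) w πs eq = begin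
    e + (c + des (r ∷ πs))  ≡⟨ solve 3 (λ e c D → e :+ (c :+ D) := c :+ (e :+ D)) refl e c (des (r ∷ πs)) ⟩
    c + (e + des (r ∷ πs))  ≡⟨ cong (λ z → c + z) eq ⟩
    c + des (r ∷ w)         ∎
    where
    open ≡-Reasoning
    open +-*-Solver
    c = 𝟙 (r <ᵇ q)

  -- Only `des (r ∷ w)` changes, and by `des-move` it grows by just what `lower` adds to `e`.
  Lower-move : ∀ {e x} P w πs → x ∉ P → Lower e P w πs → Lower (lower P x w e) P (x ∷ w) πs
  Lower-move         []      w πs x∉P eq = tt
  Lower-move {e} {x} (r ∷ P) w πs x∉P eq = begin
    e + n + des (r ∷ πs)    ≡⟨ solve 3 (λ e n D → e :+ n :+ D := e :+ D :+ n) refl e n (des (r ∷ πs)) ⟩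
    e + des (r ∷ πs) + n    ≡⟨ cong (λ z → z + n) eq ⟩
    des (r ∷ w) + n         ≡⟨ des-move w (x∉P ∘ here ∘ sym) ⟨
    des (r ∷ x ∷ w)         ∎
    where
    open ≡-Reasoning
    open +-*-Solver
    n = 𝟙 (not (raises r x w))

  module _ {s₀} (p₀ : Interleaving (reverse θ) (reverse π) s₀) where

    subσ-state : ∀ {U P s} w πs → Interleaving U P s → reverse s₀ ≡ s ʳ++ w → π ≡ P ʳ++ πs →
      All (_∈ θ) U → All (λ x → x ∈ θ ⊎ x ∈ πs) w →
      subσ θ π (reverse s₀) (suc (length P)) ≡ U ʳ++ w
    subσ-state {U} {P} {s} w πs p σ≡ π≡ U∈ w∈ = begin
      subσ θ π (reverse s₀) (suc (length P))           ≡⟨ subσ-suc θ π (reverse s₀) (length P) P≤π start ⟩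
      filter (keep? (length P)) (reverse s₀)           ≡⟨ cong (filter (keep? (length P))) σ≡ ⟩
      filter (keep? (length P)) (s ʳ++ w)              ≡⟨ filter-state w πs p π≡ U∈ w∈ ⟩
      U ʳ++ w                                          ∎
      where
      open ≡-Reasoning
      P≤π : length P ≤ length π
      P≤π = subst (length P ≤_) (sym (trans (cong length π≡) (LP.length-ʳ++ P))) (ℕP.m≤m+n _ _)
      -- In the initial state, with nothing placed and no letter of π kept, `filter-state` gives the
      -- equation that `subσ-suc` asks for.
      start : filter (keep? (length π)) (reverse s₀) ≡ θ
      start = begin
        filter (keep? (length π)) (reverse s₀)           ≡⟨ cong (λ k → filter (keep? k) (reverse s₀)) (LP.length-reverse π) ⟨
        filter (keep? (length (reverse π))) (reverse s₀) ≡⟨ filter-state [] [] p₀ (sym (LP.reverse-involutive π)) (All.tabulate ∈-reverse⁻) [] ⟩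
        reverse (reverse θ)                              ≡⟨ LP.reverse-involutive θ ⟩
        θ                                                ∎

    -- When `r` is taken with `P` left behind it, `r` is `π(i)` for `i = length P + 1`. The labels
    -- therefore appear with decreasing index, which explains `downFrom`.
    labels≡tᵢ : ∀ {U P s} (p : Interleaving U P s) e w πs → reverse s₀ ≡ s ʳ++ w → π ≡ P ʳ++ πs →
      All (_∈ θ) U → All (λ x → x ∈ θ ⊎ x ∈ πs) w → Lower e P w πs →
      map +_ (labels p e w) ≡ map (tᵢ θ π (reverse s₀) ∘ suc) (downFrom (length P))
    labels≡tᵢ []                        e w πs σ≡ π≡ U∈ w∈ lo = refl
    labels≡tᵢ {x ∷ U} {P}     (consˡ p) e w πs σ≡ π≡ (x∈ ∷ U∈) w∈ lo =
      labels≡tᵢ p (lower P x w e) (x ∷ w) πs σ≡ π≡ U∈ (inj₁ x∈ ∷ w∈) (Lower-move P w πs x∉P lo)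
      where
      x∉P : x ∉ P
      x∉P x∈P = θ#π (x∈ , subst (x ∈_) (sym π≡) (reverseAcc⁺ πs P (inj₂ x∈P)))
    labels≡tᵢ {U}     {r ∷ P} (consʳ p) e w πs σ≡ π≡ U∈ w∈ lo = cong₂ _∷_
      (begin
        + endpoint r U w e
          ≡⟨ difference {m′ = maj (U ʳ++ w)} {D = des (r ∷ πs)} (maj-insert U r w e lo) ⟩
        + maj (U ʳ++ r ∷ w) - + maj (U ʳ++ w) - + des (r ∷ πs)
          ≡⟨ cong (λ z → + maj (U ʳ++ r ∷ w) - + maj (U ʳ++ w) - + z)
               (trans (cong (d (suc (length P))) π≡) (d-suffix P (r ∷ πs))) ⟨
        + maj (U ʳ++ r ∷ w) - + maj (U ʳ++ w) - + d (suc (length P)) π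
          ≡⟨ cong₂ (λ y z → + maj y - + maj z - + d (suc (length P)) π)
               (subσ-state (r ∷ w) (r ∷ πs) p σ≡ π≡ U∈ w∈′)
               (subσ-state w πs (consʳ p) σ≡ π≡ U∈ w∈) ⟨
        tᵢ θ π (reverse s₀) (suc (length P)) ∎)
      (labels≡tᵢ p e (r ∷ w) (r ∷ πs) σ≡ π≡ U∈ w∈′ (Lower-place P w πs lo))
      where
      open ≡-Reasoning
      w∈′ : All (λ x → x ∈ θ ⊎ x ∈ r ∷ πs) (r ∷ w)
      w∈′ = inj₂ (here refl) ∷ All.map [ inj₁ , inj₂ ∘ there ]′ w∈

    labels↭Φ : map +_ (labels p₀ 0 []) ↭ Φ θ π (reverse s₀)
    labels↭Φ = begin
      map +_ (labels p₀ 0 [])               ≡⟨ labels≡tᵢ p₀ 0 [] [] refl (sym (LP.reverse-involutive π))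
                                                 (All.tabulate ∈-reverse⁻) [] (initial (reverse π)) ⟩
      map t (downFrom (length (reverse π))) ≡⟨ cong (map t ∘ downFrom) (LP.length-reverse π) ⟩
      map t (downFrom (length π))           ≡⟨ cong (map t) (LP.reverse-upTo (length π)) ⟨
      map t (reverse (upTo (length π)))     ↭⟨ ↭-map⁺ t (↭-reverse (upTo (length π))) ⟩
      map t (upTo (length π))               ≡⟨ LP.map-∘ (upTo (length π)) ⟩
      Φ θ π (reverse s₀)                    ∎
      where
      open PermutationReasoning
      t = tᵢ θ π (reverse s₀) ∘ suc
      initial : ∀ P → Lower 0 P [] []
      initial []      = tt
      initial (_ ∷ _) = refl

-- Shuffles as interleavings

disjoint-⊆-length : ∀ {θ π σ : Word} → θ ⊆ σ → π ⊆ σ → Disjoint θ π → length θ + length π ≤ length σ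
disjoint-⊆-length []         []         dj = z≤n
disjoint-⊆-length (y ∷ʳ p)   (.y ∷ʳ q)  dj = ℕP.m≤n⇒m≤1+n (disjoint-⊆-length p q dj)
disjoint-⊆-length (refl ∷ p) (_ ∷ʳ q)   dj = s≤s (disjoint-⊆-length p q λ (i , j) → dj (there i , j))
disjoint-⊆-length {θ} (_∷ʳ_ {ys = σ} _ p) (_∷_ {xs = π} refl q) dj =
  subst (_≤ suc (length σ)) (sym (ℕP.+-suc (length θ) (length π))) (s≤s (disjoint-⊆-length p q λ (i , j) → dj (i , there j)))
disjoint-⊆-length (refl ∷ p) (refl ∷ q) dj = ⊥-elim (dj (here refl , here refl))

-- A letter of σ skipped by both embeddings would leave too little room by `disjoint-⊆-length`, and
-- disjointness forbids one used by both.
⊆⇒interleaving : ∀ {θ π σ : Word} → θ ⊆ σ → π ⊆ σ → Disjoint θ π → length σ ≤ length θ + length π →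
  Interleaving θ π σ
⊆⇒interleaving []         []         dj len = []
⊆⇒interleaving (y ∷ʳ p)   (.y ∷ʳ q)  dj len = contradiction (ℕP.≤-trans len (disjoint-⊆-length p q dj)) ℕP.1+n≰n
⊆⇒interleaving (refl ∷ p) (_ ∷ʳ q)   dj len = consˡ (⊆⇒interleaving p q (λ (i , j) → dj (there i , j)) (s≤s⁻¹ len))
⊆⇒interleaving {θ} (_∷ʳ_ {ys = σ} _ p) (_∷_ {xs = π} refl q) dj len =
  consʳ (⊆⇒interleaving p q (λ (i , j) → dj (i , there j))
    (s≤s⁻¹ (subst (suc (length σ) ≤_) (ℕP.+-suc (length θ) (length π)) len)))
⊆⇒interleaving (refl ∷ p) (refl ∷ q) dj len = ⊥-elim (dj (here refl , here refl))

interleaving⇒⊆ˡ : ∀ {θ π σ : Word} → Interleaving θ π σ → θ ⊆ σ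
interleaving⇒⊆ˡ []        = []
interleaving⇒⊆ˡ (consˡ p) = refl ∷ interleaving⇒⊆ˡ p
interleaving⇒⊆ˡ (consʳ p) = _ ∷ʳ interleaving⇒⊆ˡ p

interleaving⇒⊆ʳ : ∀ {θ π σ : Word} → Interleaving θ π σ → π ⊆ σ
interleaving⇒⊆ʳ []        = []
interleaving⇒⊆ʳ (consˡ p) = _ ∷ʳ interleaving⇒⊆ʳ p
interleaving⇒⊆ʳ (consʳ p) = refl ∷ interleaving⇒⊆ʳ p

∈-range : ∀ {n x} → 1 ≤ x → x ≤ n → x ∈ range n
∈-range (s≤s _) x≤n = ∈-map⁺ suc (∈-upTo⁺ x≤n)

-- Both lists are free of repetitions and have the same members, hence are equal as bags.
complement-++ : ∀ {n π} → Unique π → All (λ x → 1 ≤ x × x ≤ n) π →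
  filter (λ x → ¬? (x ∈? π)) (range n) ++ π ↭ range n
complement-++ {n} {π} π! π∈ = ∼bag⇒↭ (unique∧set⇒bag
  (Unique-++⁺ (Unique-filter⁺ out? range!) π! (λ (i , j) → proj₂ (∈-filter⁻ out? {xs = range n} i) j))
  range!
  (mk⇔ to from))
  where
  out? : Decidable (_∉ π)
  out? x = ¬? (x ∈? π)
  range! : Unique (range n)
  range! = Unique-map⁺ ℕP.suc-injective (upTo⁺ n)
  to : ∀ {x} → x ∈ filter out? (range n) ++ π → x ∈ range n
  to i with ∈-++⁻ (filter out? (range n)) i
  ... | inj₁ j = proj₁ (∈-filter⁻ out? {xs = range n} j)
  ... | inj₂ j = let l , u = All.lookup π∈ j in ∈-range l u
  from : ∀ {x} → x ∈ range n → x ∈ filter out? (range n) ++ π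
  from {x} i with x ∈? π
  ... | yes x∈π = ∈-++⁺ʳ (filter out? (range n)) x∈π
  ... | no  x∉π = ∈-++⁺ˡ (∈-filter⁺ out? i x∉π)

-- Transfer of bijectivity from labels to `Φ`

theorem4p1 : (n a : ℕ) (π θ : List ℕ) →
    1 ≤ n → 1 ≤ a → a ≤ n →
    length π ≡ a → Unique π → All (λ x → 1 ≤ x × x ≤ n) π →
    θ ↭ filter (λ x → ¬? (x ∈? π)) (range n) →
    ((σ : List ℕ) → IsShuffle n θ π σ →
    ∃ λ (μ : List ℕ) → IsPartition (n ∸ a) a μ × Φ θ π σ ↭ map +_ μ)
    × ((σ σ′ : List ℕ) → IsShuffle n θ π σ → IsShuffle n θ π σ′ →
    Φ θ π σ ↭ Φ θ π σ′ → σ ≡ σ′)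
    × ((μ : List ℕ) → IsPartition (n ∸ a) a μ →
    ∃ λ (σ : List ℕ) → IsShuffle n θ π σ × Φ θ π σ ↭ map +_ μ)
theorem4p1 n .(length π) π θ _ _ _ refl π! π∈ θ↭ = partition , injective , surjective
  where
  b = n ∸ length π

  θ#π : Disjoint θ π
  θ#π (i , j) = proj₂ (∈-filter⁻ (λ x → ¬? (x ∈? π)) {xs = range n} (∈-resp-↭ θ↭ i)) j

  θ++π↭range : θ ++ π ↭ range n
  θ++π↭range = ↭-trans (++⁺ʳ π θ↭) (complement-++ π! π∈)

  length-θ : length (reverse θ) ≡ b
  length-θ = begin
    length (reverse θ)              ≡⟨ LP.length-reverse θ ⟩
    length θ                        ≡⟨ ℕP.m+n∸n≡m (length θ) (length π) ⟨
    length θ + length π ∸ length π  ≡⟨ cong (_∸ length π) (LP.length-++ θ) ⟨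
    length (θ ++ π) ∸ length π      ≡⟨ cong (_∸ length π) (↭-length θ++π↭range) ⟩
    length (range n) ∸ length π     ≡⟨ cong (_∸ length π) (trans (LP.length-map suc (upTo n)) (LP.length-upTo n)) ⟩
    b                               ∎
    where open ≡-Reasoning

  -- All three words are reversed because `labels` reads a shuffle from its last letter.
  interleaving : ∀ {σ} → IsShuffle n θ π σ → Interleaving (reverse θ) (reverse π) (reverse σ)
  interleaving (σ↭ , θ⊆ , π⊆) = reverse⁺ (⊆⇒interleaving θ⊆ π⊆ θ#π
    (ℕP.≤-reflexive (trans (↭-length (↭-trans σ↭ (↭-sym θ++π↭range))) (LP.length-++ θ))))

  shuffle : ∀ {s} → Interleaving (reverse θ) (reverse π) s → IsShuffle n θ π (reverse s)
  shuffle {s} p = ↭-trans (toPermutation q) θ++π↭range , interleaving⇒⊆ˡ q , interleaving⇒⊆ʳ q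
    where
    q : Interleaving θ π (reverse s)
    q = reverse⁻ (subst (Interleaving _ _) (sym (LP.reverse-involutive s)) p)

  labels↭Φσ : ∀ {σ} (sh : IsShuffle n θ π σ) → map +_ (labels (interleaving sh) 0 []) ↭ Φ θ π σ
  labels↭Φσ {σ} sh = subst (λ z → map +_ (labels (interleaving sh) 0 []) ↭ Φ θ π z) (LP.reverse-involutive σ) (labels↭Φ θ#π π! (interleaving sh))

  partition : ∀ σ → IsShuffle n θ π σ → ∃ λ μ → IsPartition b (length π) μ × Φ θ π σ ↭ map +_ μ
  -- The labels come in no particular order; sorting picks the weakly increasing representative of
  -- their multiset.
  partition σ sh = sort ls
    , ( trans (↭-length (sort-↭ ls)) (trans (length-labels p 0 []) (LP.length-reverse π))
      , All-resp-↭ (↭-sym (sort-↭ ls)) (All.map (λ {t} (_ , u) → subst (t ≤_) length-θ u) (labels-within p 0 []))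
      , sort-↗ ls)
    , ↭-trans (↭-sym (labels↭Φσ sh)) (↭-map⁺ +_ (↭-sym (sort-↭ ls)))
    where
    p  = interleaving sh
    ls = labels p 0 []

  injective : ∀ σ σ′ → IsShuffle n θ π σ → IsShuffle n θ π σ′ → Φ θ π σ ↭ Φ θ π σ′ → σ ≡ σ′
  injective σ σ′ sh sh′ eq = LP.reverse-injective (labels-injective (interleaving sh) (interleaving sh′) 0 []
    (map-+-injective (↭-trans (labels↭Φσ sh) (↭-trans eq (↭-sym (labels↭Φσ sh′))))))
    where
    map-+-injective : ∀ {xs ys} → map +_ xs ↭ map +_ ys → xs ↭ ys
    map-+-injective eq with zs , ys≡ , xs↭zs ← ↭-map-inv +_ eq =
      ↭-trans xs↭zs (↭-reflexive (LP.map-injective ℤP.+-injective (sym ys≡)))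

  surjective : ∀ μ → IsPartition b (length π) μ → ∃ λ σ → IsShuffle n θ π σ × Φ θ π σ ↭ map +_ μ
  surjective μ (len , bnd , _) =
    let s , p , eq = labels-surjective (reverse θ) (reverse π) 0 [] μ (trans len (sym (LP.length-reverse π)))
                       (All.map (λ {t} t≤b → z≤n , subst (t ≤_) (sym length-θ) t≤b) bnd)
    in reverse s , shuffle p , ↭-trans (↭-sym (labels↭Φ θ#π π! p)) (↭-map⁺ +_ eq)
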